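{- Let $G$ be a $2$-acyclic Cayley graph with generator set $E$, and let $n\geq 3$. If the dual hypergraph $d(G)$ is an $n$-acyclic hypergraph, then the Cayley graph $G$ is $n$-acyclic.
   Context: A Cayley group is a group $G$ (finite or infinite) with a generating set $E\subseteq G$ of non-trivial involutions ($e\neq 1$, $e^2=1$ for $e\in E$). Its Cayley graph, also denoted $G$, has vertex set $G$ and $e$-labelled edges $\{v,ve\}$ for $v\in G$, $e\in E$. For $\alpha\subseteq E$, $G_\alpha$ is the subgroup generated by $\alpha$, and $[v]_\alpha=vG_\alpha$ is the $\alpha$-coset of $v$. A coset cycle of length $m$ in $G$ is a sequence $((v_i,\alpha_i))_{i\in\mathbb{Z}_m}$ with $v_i\in G$, $\alpha_i\subseteq E$, such that for all $i\in\mathbb{Z}_m$: $v_i^{ -1}v_{i+1}\in G_{\alpha_i}$ and $[v_i]_{\alpha_{i-1}\cap\alpha_i}\cap[v_{i+1}]_{\alpha_i\cap\alpha_{i+1}}=\emptyset$. A Cayley graph is $n$-acyclic if it has no coset cycle of length at most $n$. A hypergraph is a pair $(A,S)$ with $S\subseteq\mathcal{P}(A)$. Its Gaifman graph is the undirected graph on $A$ linking distinct $a,a'$ whenever $a,a'\in s$ for some $s\in S$. For $n\geq 3$ the hypergraph is $n$-acyclic if it is (i) $n$-conformal: every clique of size at most $n$ in the Gaifman graph is contained in some hyperedge $s\in S$; and (ii) $n$-chordal: every cycle in the Gaifman graph of length greater than $3$ and at most $n$ has a chord, i.e. an edge between two vertices that are not neighbours along the cycle. The dual hypergraph $d(G)$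 has as vertex set the disjoint union over all $\alpha\subseteq E$ of the sets $Q_\alpha=\{[v]_\alpha: v\in G\}$ (the vertices in $Q_\alpha$ being coloured by $\alpha$), and as hyperedges the sets $[\![v]\!]=\{[v]_\alpha:\alpha\subseteq E\}$ for $v\in G$. -}

module Defs where

open import Level using (Level; _⊔_) renaming (suc to lsuc)
open import Algebra.Bundles using (Group)
open import Data.Fin.Base using (Fin; toℕ)
open import Data.Nat.Base using (ℕ; suc; pred; _+_; _≤_; _<_; NonZero)
open import Data.Nat.DivMod using (_mod_)
open import Data.Product using (_×_; _,_; ∃-syntax)
open import Relation.Binary.Bundles using (Setoid)
open import Relation.Binary.Core using (Rel)
open import Relation.Binary.Definitions using (_Respects_)
open import Relation.Binary.PropositionalEquality using (_≢_)
open import Relation.Nullary.Negation using (¬_)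
open import Relation.Unary using (Pred; _∈_; _⊆_; _≐_; _∩_; Empty)
open import Relation.Unary.Properties using (≐-refl; ≐-sym; ≐-trans)

-- Fin m serves as ℤ_m; these are i ↦ i + 1 and i ↦ i - 1 modulo m.

next : ∀ {m} .{{_ : NonZero m}} → Fin m → Fin m
next {m} i = suc (toℕ i) mod m

prev : ∀ {m} .{{_ : NonZero m}} → Fin m → Fin m
prev {m} i = (toℕ i + pred m) mod m

record Hypergraph (a ℓ s t : Level) : Set (lsuc (a ⊔ ℓ ⊔ s ⊔ t)) where
  field
    vertices : Setoid a ℓ
  open Setoid vertices public
    using () renaming (Carrier to Vertex; _≈_ to _≈ᵥ_)
  field
    Hyperedge      : Pred (Pred Vertex s) t
    Hyperedge-resp : Hyperedge Respects _≐_
    vertex-resp    : ∀ {S} → Hyperedge S → S Respects _≈ᵥ_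

module _ {a ℓ s t} (H : Hypergraph a ℓ s t) where
  open Hypergraph H

  Gaifman : Rel Vertex (a ⊔ ℓ ⊔ lsuc s ⊔ t)
  Gaifman x y = ¬ (x ≈ᵥ y) × (∃[ S ] Hyperedge S × x ∈ S × y ∈ S)

  -- A clique of size k is enumerated by Fin k; since Gaifman relates only
  -- distinct vertices, the enumeration is without repetition.

  IsClique : ∀ {k} → (Fin k → Vertex) → Set (a ⊔ ℓ ⊔ lsuc s ⊔ t)
  IsClique f = ∀ i j → i ≢ j → Gaifman (f i) (f j)

  Conformal : ℕ → Set (a ⊔ ℓ ⊔ lsuc s ⊔ t)
  Conformal n = ∀ k → k ≤ n → (f : Fin k → Vertex) → IsClique f →
                ∃[ S ] Hyperedge S × (∀ i → f i ∈ S)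

  record IsCycle {m} .{{_ : NonZero m}} (f : Fin m → Vertex)
         : Set (a ⊔ ℓ ⊔ lsuc s ⊔ t) where
    field
      distinct : ∀ i j → i ≢ j → ¬ (f i ≈ᵥ f j)
      adjacent : ∀ i → Gaifman (f i) (f (next i))

  HasChord : ∀ {m} .{{_ : NonZero m}} → (Fin m → Vertex) →
             Set (a ⊔ ℓ ⊔ lsuc s ⊔ t)
  HasChord f = ∃[ i ] ∃[ j ] i ≢ j × j ≢ next i × i ≢ next j ×
               Gaifman (f i) (f j)

  Chordal : ℕ → Set (a ⊔ ℓ ⊔ lsuc s ⊔ t)
  Chordal n = ∀ m → .{{_ : NonZero m}} → 3 < m → m ≤ n →
              (f : Fin m → Vertex) → IsCycle f → HasChord f

  -- The notion is only meant for n ≥ 3.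

  HypergraphAcyclic : ℕ → Set (a ⊔ ℓ ⊔ lsuc s ⊔ t)
  HypergraphAcyclic n = Conformal n × Chordal n

-- The subgroup generated by α, that is, the least subgroup containing α.

module _ {c ℓ p : Level} (Γ : Group c ℓ) where
  open Group Γ

  data Generated (α : Pred Carrier p) : Pred Carrier (c ⊔ ℓ ⊔ p) where
    gen  : ∀ {g} → g ∈ α → Generated α g
    unit : Generated α ε
    mul  : ∀ {g h} → Generated α g → Generated α h → Generated α (g ∙ h)
    inv  : ∀ {g} → Generated α g → Generated α (g ⁻¹)
    resp : ∀ {g h} → g ≈ h → Generated α g → Generated α h

record CayleyGroup (c ℓ p : Level) : Set (lsuc (c ⊔ ℓ ⊔ p)) where
  field
    group : Group c ℓ
  open Group group public
  field
    E            : Pred Carrier p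
    E-resp       : E Respects _≈_
    E-nontrivial : ∀ {e} → e ∈ E → ¬ (e ≈ ε)
    E-involutive : ∀ {e} → e ∈ E → e ∙ e ≈ ε
    E-generates  : ∀ g → g ∈ Generated group E

module _ {c ℓ p} (G : CayleyGroup c ℓ p) where
  open CayleyGroup G using (Carrier; _≈_; _∙_; _⁻¹; E; group)

  record SubsetE : Set (c ⊔ ℓ ⊔ lsuc p) where
    field
      set      : Pred Carrier p
      set-resp : set Respects _≈_
      set⊆E    : set ⊆ E
  open SubsetE using (set)

  infixr 7 _∩ₑ_
  _∩ₑ_ : SubsetE → SubsetE → SubsetE
  α ∩ₑ β = record
    { set      = set α ∩ set β
    ; set-resp = λ x≈y (x∈α , x∈β) →
        SubsetE.set-resp α x≈y x∈α , SubsetE.set-resp β x≈y x∈β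
    ; set⊆E    = λ (x∈α , _) → SubsetE.set⊆E α x∈α
    }

  coset : Carrier → SubsetE → Pred Carrier (c ⊔ ℓ ⊔ p)
  coset v α w = ∃[ g ] g ∈ Generated group (set α) × w ≈ v ∙ g

  record CosetCycle (m : ℕ) .{{_ : NonZero m}} : Set (c ⊔ ℓ ⊔ lsuc p) where
    field
      v        : Fin m → Carrier
      α        : Fin m → SubsetE
      step     : ∀ i → (v i ⁻¹ ∙ v (next i)) ∈ Generated group (set (α i))
      disjoint : ∀ i → Empty (coset (v i) (α (prev i) ∩ₑ α i)
                            ∩ coset (v (next i)) (α i ∩ₑ α (next i)))

  -- Lengths are positive: the empty family over Fin 0 would satisfy the
  -- conditions vacuously.

  CayleyAcyclic : ℕ → Set (c ⊔ ℓ ⊔ lsuc p)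
  CayleyAcyclic n = ∀ m → .{{_ : NonZero m}} → m ≤ n → ¬ CosetCycle m

  -- A pair (α , v) represents the coset [v]_α in Q_α.  The vertex set is the
  -- disjoint union of the Q_α, so equal cosets of different colours are
  -- different vertices.

  CosetVertex : Set (c ⊔ ℓ ⊔ lsuc p)
  CosetVertex = SubsetE × Carrier

  _≈ᶜ_ : Rel CosetVertex (c ⊔ ℓ ⊔ p)
  (α , v) ≈ᶜ (β , w) = set α ≐ set β × coset v α ≐ coset w β

  cosetSetoid : Setoid (c ⊔ ℓ ⊔ lsuc p) (c ⊔ ℓ ⊔ p)
  cosetSetoid = record
    { Carrier       = CosetVertex
    ; _≈_           = _≈ᶜ_
    ; isEquivalence = record
      { refl  = ≐-refl , ≐-refl
      ; sym   = λ (p , q) → ≐-sym p , ≐-sym q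
      ; trans = λ (p , q) (r , s) → ≐-trans p r , ≐-trans q s
      }
    }

  ⟦_⟧ : Carrier → Pred CosetVertex (c ⊔ ℓ ⊔ lsuc p)
  ⟦ v ⟧ x = ∃[ α ] x ≈ᶜ (α , v)

  dual : Hypergraph (c ⊔ ℓ ⊔ lsuc p) (c ⊔ ℓ ⊔ p)
                    (c ⊔ ℓ ⊔ lsuc p) (c ⊔ ℓ ⊔ lsuc p)
  dual = record
    { vertices       = cosetSetoid
    ; Hyperedge      = λ S → ∃[ v ] S ≐ ⟦ v ⟧
    ; Hyperedge-resp = λ S≐T (v , S≐v) → v , ≐-trans (≐-sym S≐T) S≐v
    ; vertex-resp    = λ (v , S⊆v , v⊆S) {x} {y} x≈y x∈S →
        let (α , x≈αv) = S⊆v x∈S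
        in v⊆S (α , trans {y} {x} {α , v} (sym {x} {y} x≈y) x≈αv)
    }
    where open Setoid cosetSetoid using (sym; trans)

{-# OPTIONS --safe #-}

-- The cosets aₖ = [vₖ]_{αₖ} of a coset cycle, read as a periodic sequence,
-- meet consecutively, aₖ and aₖ₊₁ in vₖ₊₁.  By induction on d, the cosets aₖ
-- and aₖ₊d are disjoint whenever 2 ≤ d < n.  For d = 2, conformality would give
-- a common point of aₖ, aₖ₊₁ and aₖ₊₂, which by 2-acyclicity lies in both
-- [vₖ₊₁]_{αₖ∩αₖ₊₁} and [vₖ₊₂]_{αₖ₊₁∩αₖ₊₂}.  For d > 2, aₖ, …, aₖ₊d would be a
-- cycle of the Gaifman graph, and a chord of it joins cosets at a distance
-- between 2 and d − 1.  But in a coset cycle of length m the cosets a₀ and aₘ₋₁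
-- meet in v₀.

module Submission where

open import Defs
open import Data.Empty using (⊥; ⊥-elim)
open import Data.Fin.Base using (Fin; zero; suc; toℕ)
open import Data.Fin.Properties using (toℕ-injective; toℕ<n; toℕ-fromℕ<)
open import Data.Nat.Base
  using (ℕ; zero; suc; pred; _+_; _∸_; _%_; _≤_; _<_; z≤n; s≤s; NonZero; >-nonZero)
open import Data.Nat.DivMod
  using (_mod_; n%n≡0; [m+n]%n≡m%n; m<n⇒m%n≡m; m%n%n≡m%n; %-distribˡ-+)
open import Data.Nat.Induction using (<-rec)
open import Data.Nat.Properties
open import Data.Product using (_×_; _,_; proj₁; proj₂; ∃-syntax)
open import Data.Sum.Base using (inj₁; inj₂)
open import Function.Base using (_∘_; case_of_)
open import Relation.Binary.Bundles using (Setoid)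
open import Relation.Binary.Definitions using (tri<; tri≈; tri>)
open import Relation.Binary.PropositionalEquality
  using (_≡_; _≢_; refl; sym; trans; cong; subst; module ≡-Reasoning)
open import Relation.Nullary.Decidable using (yes; no)
open import Relation.Nullary.Negation using (¬_)
open import Relation.Unary using (Pred; _∈_; _⊆_; _∩_; Empty)

-- Cyclic indices and residues modulo `m`.

toℕ-mod : ∀ k m .{{_ : NonZero m}} → toℕ (k mod m) ≡ k % m
toℕ-mod k m = toℕ-fromℕ< _

mod-cong : ∀ k l m .{{_ : NonZero m}} → k % m ≡ l % m → k mod m ≡ l mod m
mod-cong k l m eq =
  toℕ-injective (trans (toℕ-mod k m) (trans eq (sym (toℕ-mod l m))))

%-+-congˡ : ∀ k l m .{{_ : NonZero m}} → (k % m + l) % m ≡ (k + l) % m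
%-+-congˡ k l m = begin
  (k % m + l) % m            ≡⟨ %-distribˡ-+ (k % m) l m ⟩
  ((k % m) % m + l % m) % m  ≡⟨ cong (λ r → (r + l % m) % m) (m%n%n≡m%n k m) ⟩
  (k % m + l % m) % m        ≡⟨ %-distribˡ-+ k l m ⟨
  (k + l) % m                ∎
  where open ≡-Reasoning

next-mod : ∀ k m .{{_ : NonZero m}} → next (k mod m) ≡ suc k mod m
next-mod k m = mod-cong (suc (toℕ (k mod m))) (suc k) m (begin
  suc (toℕ (k mod m)) % m  ≡⟨ cong (λ r → suc r % m) (toℕ-mod k m) ⟩
  suc (k % m) % m          ≡⟨ cong (_% m) (+-comm 1 (k % m)) ⟩
  (k % m + 1) % m          ≡⟨ %-+-congˡ k 1 m ⟩
  (k + 1) % m              ≡⟨ cong (_% m) (+-comm k 1) ⟩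
  suc k % m                ∎)
  where open ≡-Reasoning

prev-mod : ∀ k m .{{_ : NonZero m}} → prev (suc k mod m) ≡ k mod m
prev-mod k m@(suc m-1) = mod-cong (toℕ (suc k mod m) + m-1) k m (begin
  (toℕ (suc k mod m) + m-1) % m  ≡⟨ cong (λ r → (r + m-1) % m) (toℕ-mod (suc k) m) ⟩
  (suc k % m + m-1) % m          ≡⟨ %-+-congˡ (suc k) m-1 m ⟩
  (suc k + m-1) % m              ≡⟨ cong (_% m) (+-suc k m-1) ⟨
  (k + m) % m                    ≡⟨ [m+n]%n≡m%n k m ⟩
  k % m                          ∎)
  where open ≡-Reasoning

toℕ-next-< : ∀ {d} (x : Fin (suc d)) → toℕ x < d → toℕ (next x) ≡ suc (toℕ x)
toℕ-next-< {d} x x<d = trans (toℕ-mod (suc (toℕ x)) (suc d)) (m<n⇒m%n≡m (s≤s x<d))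

toℕ-next-last : ∀ {d} (x : Fin (suc d)) → toℕ x ≡ d → toℕ (next x) ≡ 0
toℕ-next-last {d} x x≡d = begin
  toℕ (next x)         ≡⟨ toℕ-mod (suc (toℕ x)) (suc d) ⟩
  suc (toℕ x) % suc d  ≡⟨ cong (λ r → suc r % suc d) x≡d ⟩
  suc d % suc d        ≡⟨ n%n≡0 (suc d) ⟩
  0                    ∎
  where open ≡-Reasoning

-- Cosets of generated subgroups.

module _ {c ℓ p} (Γ : CayleyGroup c ℓ p) where
  open CayleyGroup Γ
    using (_∙_; ε; _⁻¹; group; identityʳ; assoc; ∙-congˡ; ∙-congʳ)
    renaming (Carrier to G; sym to ≈-sym; trans to ≈-trans)
  open import Algebra.Properties.Group group
    using (\\-leftDividesˡ; \\-leftDividesʳ; //-rightDividesʳ)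
  open SubsetE using (set)

  Generated-mono : {S T : Pred G p} → S ⊆ T → Generated group S ⊆ Generated group T
  Generated-mono S⊆T (gen g∈S)   = gen (S⊆T g∈S)
  Generated-mono S⊆T unit        = unit
  Generated-mono S⊆T (mul g h)   = mul (Generated-mono S⊆T g) (Generated-mono S⊆T h)
  Generated-mono S⊆T (inv g)     = inv (Generated-mono S⊆T g)
  Generated-mono S⊆T (resp eq g) = resp eq (Generated-mono S⊆T g)

  coset-refl : ∀ α {x} → x ∈ coset Γ x α
  coset-refl α {x} = ε , unit , ≈-sym (identityʳ x)

  coset-sym : ∀ α {x y} → y ∈ coset Γ x α → x ∈ coset Γ y α
  coset-sym α {x} {y} (g , g∈α , y≈xg) =
    g ⁻¹ , inv g∈α ,
    ≈-sym (≈-trans (∙-congʳ y≈xg) (//-rightDividesʳ g x))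

  coset-trans : ∀ α {x y z} → y ∈ coset Γ x α → z ∈ coset Γ y α → z ∈ coset Γ x α
  coset-trans α {x} (g , g∈α , y≈xg) (h , h∈α , z≈yh) =
    g ∙ h , mul g∈α h∈α , ≈-trans z≈yh (≈-trans (∙-congʳ y≈xg) (assoc x g h))

  coset-mono : ∀ α β {x} → set α ⊆ set β → coset Γ x α ⊆ coset Γ x β
  coset-mono α β α⊆β (g , g∈α , y≈xg) = g , Generated-mono α⊆β g∈α , y≈xg

  \\-∈⇒coset : ∀ α {x y} → x ⁻¹ ∙ y ∈ Generated group (set α) → y ∈ coset Γ x α
  \\-∈⇒coset α {x} {y} x⁻¹y∈α = x ⁻¹ ∙ y , x⁻¹y∈α , ≈-sym (\\-leftDividesˡ x y)

  coset⇒\\-∈ : ∀ α {x y} → y ∈ coset Γ x α → x ⁻¹ ∙ y ∈ Generated group (set α)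
  coset⇒\\-∈ α {x} {y} (g , g∈α , y≈xg) =
    resp (≈-sym (≈-trans (∙-congˡ y≈xg) (\\-leftDividesʳ x g))) g∈α

  -- If `y` were outside the `α ∩ β`-coset of `x`, then `x`, `y` with colours `α`, `β` would form a
  -- coset cycle of length 2: both disjointness conditions compare the `α ∩ β`-cosets of `x` and
  -- `y`. Acyclicity is a negative statement, hence the double negation.
  coset-∩ : CayleyAcyclic Γ 2 → ∀ α β {x y} →
            y ∈ coset Γ x α → y ∈ coset Γ x β → ¬ ¬ (y ∈ coset Γ x (_∩ₑ_ Γ α β))
  coset-∩ acyclic α β {x} {y} y∈xα y∈xβ y∉xαβ = acyclic 2 ≤-refl record
    { v        = λ { zero → x ; (suc zero) → y }
    ; α        = λ { zero → α ; (suc zero) → β }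
    ; step     = λ { zero       → coset⇒\\-∈ α y∈xα
                   ; (suc zero) → coset⇒\\-∈ β (coset-sym β y∈xβ) }
    ; disjoint = λ { zero       w (w∈x , w∈y) → meet w∈x w∈y
                   ; (suc zero) w (w∈y , w∈x) → meet w∈x w∈y }
    }
    where
    αβ = _∩ₑ_ Γ α β
    βα = _∩ₑ_ Γ β α
    meet : ∀ {w} → w ∈ coset Γ x βα → w ∈ coset Γ y αβ → ⊥
    meet w∈x w∈y = y∉xαβ
      (coset-trans αβ (coset-mono βα αβ (λ (b , a) → a , b) w∈x) (coset-sym αβ w∈y))

  -- Incidence and adjacency in the dual hypergraph.

  open Hypergraph (dual Γ) using (Vertex; _≈ᵥ_; vertices)
  open Setoid vertices using () renaming (sym to ≈ᵥ-sym)

  infix 4 _∋_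
  _∋_ : Vertex → G → Set _
  (α , x) ∋ u = u ∈ coset Γ x α

  -- Adjacency in the Gaifman graph up to distinctness, since the hyperedge `⟦ u ⟧` consists of the
  -- cosets containing `u`.
  Meet : Vertex → Vertex → Set _
  Meet a b = ∃[ u ] a ∋ u × b ∋ u

  Meet-sym : ∀ a b → Meet a b → Meet b a
  Meet-sym _ _ (u , a∋u , b∋u) = u , b∋u , a∋u

  Meet-respˡ : ∀ a b d → a ≈ᵥ b → Meet a d → Meet b d
  Meet-respˡ _ _ _ (_ , a⊆b , _) (u , a∋u , d∋u) = u , a⊆b a∋u , d∋u

  ≈ᵥ⇒Meet : ∀ a b → a ≈ᵥ b → Meet a b
  ≈ᵥ⇒Meet (α , x) _ (_ , a⊆b , _) = x , coset-refl α , a⊆b (coset-refl α)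

  ∋⇒∈⟦⟧ : ∀ a {u} → a ∋ u → a ∈ ⟦_⟧ Γ u
  ∋⇒∈⟦⟧ (α , x) a∋u =
    α , ((λ e → e) , (λ e → e)) ,
    coset-trans α (coset-sym α a∋u) , coset-trans α a∋u

  ∈⟦⟧⇒∋ : ∀ a {u} → a ∈ ⟦_⟧ Γ u → a ∋ u
  ∈⟦⟧⇒∋ _ (β , _ , _ , u⊆a) = u⊆a (coset-refl β)

  Gaifman⇒Meet : ∀ {a b} → Gaifman (dual Γ) a b → Meet a b
  Gaifman⇒Meet {a} {b} (_ , S , (u , S⊆u , _) , a∈S , b∈S) =
    u , ∈⟦⟧⇒∋ a (S⊆u a∈S) , ∈⟦⟧⇒∋ b (S⊆u b∈S)

  Meet⇒Gaifman : ∀ {a b} → ¬ (a ≈ᵥ b) → Meet a b → Gaifman (dual Γ) a b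
  Meet⇒Gaifman {a} {b} a≉b (u , a∋u , b∋u) =
    a≉b , ⟦_⟧ Γ u , (u , (λ e → e) , (λ e → e)) , ∋⇒∈⟦⟧ a a∋u , ∋⇒∈⟦⟧ b b∋u

  Gaifman-sym : ∀ {a b} → Gaifman (dual Γ) a b → Gaifman (dual Γ) b a
  Gaifman-sym {a} {b} (a≉b , S , S∈ , a∈S , b∈S) =
    (λ b≈a → a≉b (≈ᵥ-sym {b} {a} b≈a)) , S , S∈ , b∈S , a∈S

  -- A hyperedge around the clique of size 3 is some `⟦ u ⟧`, and this `u` is the common point.
  conformal-triangle : ∀ {n} → 3 ≤ n → Conformal (dual Γ) n → ∀ {a b d} →
    Gaifman (dual Γ) a b → Gaifman (dual Γ) b d → Gaifman (dual Γ) a d →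
    ∃[ u ] a ∋ u × b ∋ u × d ∋ u
  conformal-triangle 3≤n conformal {a} {b} {d} ab bd ad =
    let S , (u , S⊆u , _) , f∈S = conformal 3 3≤n f clique
        f∋u = λ i → ∈⟦⟧⇒∋ (f i) (S⊆u (f∈S i))
    in u , f∋u zero , f∋u (suc zero) , f∋u (suc (suc zero))
    where
    f : Fin 3 → Vertex
    f zero             = a
    f (suc zero)       = b
    f (suc (suc zero)) = d
    clique : IsClique (dual Γ) f
    clique zero             zero             i≢i = ⊥-elim (i≢i refl)
    clique zero             (suc zero)       _   = ab
    clique zero             (suc (suc zero)) _   = ad
    clique (suc zero)       zero             _   = Gaifman-sym ab
    clique (suc zero)       (suc zero)       i≢i = ⊥-elim (i≢i refl)
    clique (suc zero)       (suc (suc zero)) _   = bd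
    clique (suc (suc zero)) zero             _   = Gaifman-sym ad
    clique (suc (suc zero)) (suc zero)       _   = Gaifman-sym bd
    clique (suc (suc zero)) (suc (suc zero)) i≢i = ⊥-elim (i≢i refl)

  -- Unrolled coset cycles, indexed by `ℕ`.

  module CosetSequence
    (v : ℕ → G) (α : ℕ → SubsetE Γ)
    (step : ∀ k → v (suc k) ∈ coset Γ (v k) (α k))
    (disjoint : ∀ k → Empty (coset Γ (v (1 + k)) (_∩ₑ_ Γ (α k) (α (1 + k)))
                           ∩ coset Γ (v (2 + k)) (_∩ₑ_ Γ (α (1 + k)) (α (2 + k)))))
    where

    -- The shift makes αₖ₋₁, which the disjointness condition involves, available
    -- at every index.
    a : ℕ → Vertex
    a k = α (1 + k) , v (1 + k)

    consecutive-meet : ∀ k → Meet (a k) (a (1 + k))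
    consecutive-meet k = v (2 + k) , step (1 + k) , coset-refl (α (2 + k))

    -- Equal vertices have equal colours, so both colours coincide with their intersection, and
    -- `v (1 + k)` lies in both cosets that `disjoint k` separates.
    consecutive-≉ : ∀ k → ¬ (a k ≈ᵥ a (1 + k))
    consecutive-≉ k ((_ , β⊆α) , (a⊆b , _)) = disjoint k (v (1 + k))
      ( coset-refl (_∩ₑ_ Γ (α k) (α (1 + k)))
      , coset-mono (α (2 + k)) (_∩ₑ_ Γ (α (1 + k)) (α (2 + k))) (λ e → β⊆α e , e)
          (a⊆b (coset-refl (α (1 + k)))))

    consecutive-Gaifman : ∀ k → Gaifman (dual Γ) (a k) (a (1 + k))
    consecutive-Gaifman k = Meet⇒Gaifman (consecutive-≉ k) (consecutive-meet k)

    module _ (2-acyclic : CayleyAcyclic Γ 2) where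

      no-triple-point : ∀ k u → a k ∋ u → a (1 + k) ∋ u → ¬ (a (2 + k) ∋ u)
      no-triple-point k u a∋u b∋u d∋u =
        -- By `step`, `v (2 + k)` is a common base point of the first two cosets, and `v (3 + k)` of
        -- the last two. The double negations can be eliminated because the goal is `⊥`.
        coset-∩ 2-acyclic α₁ α₂
          (coset-trans α₁ (coset-sym α₁ (step (1 + k))) a∋u) b∋u λ u∈v₂ →
        coset-∩ 2-acyclic α₂ α₃
          (coset-trans α₂ (coset-sym α₂ (step (2 + k))) b∋u) d∋u λ u∈v₃ →
        disjoint (1 + k) u (u∈v₂ , u∈v₃)
        where
        α₁ = α (1 + k)
        α₂ = α (2 + k)
        α₃ = α (3 + k)

      module _ {n} (3≤n : 3 ≤ n) (acyclic : HypergraphAcyclic (dual Γ) n) where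

        -- A clique needs distinct vertices, and equality of cosets is not decidable, so both cases
        -- are refuted in turn: distinct cosets get a triple point from conformality, equal ones
        -- from the point where `a k` meets `a (1 + k)`.
        ¬Meet-2 : ∀ k → ¬ Meet (a k) (a (2 + k))
        ¬Meet-2 k m = ¬¬a≈d λ a≈d →
          let (u , a∋u , b∋u) = consecutive-meet k
          in no-triple-point k u a∋u b∋u (proj₁ (proj₂ a≈d) a∋u)
          where
          ¬¬a≈d : ¬ ¬ (a k ≈ᵥ a (2 + k))
          ¬¬a≈d a≉d =
            let (u , a∋u , b∋u , d∋u) = conformal-triangle 3≤n (proj₁ acyclic)
                  (consecutive-Gaifman k) (consecutive-Gaifman (1 + k))
                  (Meet⇒Gaifman a≉d m)
            in no-triple-point k u a∋u b∋u d∋u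

        -- The induction step for `3 ≤ d`. The cycle has `suc d` vertices, so `3 ≤ d` and `d < n`
        -- are exactly the bounds under which chordality applies; `shorter` is the induction
        -- hypothesis.
        module LongShortcut
          (k d : ℕ) (3≤d : 3 ≤ d) (d<n : d < n)
          (closed : Meet (a k) (a (d + k)))
          (shorter : ∀ {e} → e < d → 2 ≤ e → ∀ j → ¬ Meet (a j) (a (e + j)))
          where

          f : Fin (suc d) → Vertex
          f x = a (toℕ x + k)

          far : ∀ {i j} → 2 + i ≤ j → j < d + i → ¬ Meet (a (i + k)) (a (j + k))
          far {i} {j} 2+i≤j j<d+i m =
            shorter {j ∸ i} j∸i<d (m+n≤o⇒m≤o∸n 2 2+i≤j) (i + k)
              (subst (Meet (a (i + k)) ∘ a) (sym j≡) m)
            where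
            i≤j : i ≤ j
            i≤j = ≤-trans (m≤n+m i 2) 2+i≤j
            j∸i<d : j ∸ i < d
            j∸i<d = +-cancelʳ-< i (j ∸ i) d (subst (_< d + i) (sym (m∸n+n≡m i≤j)) j<d+i)
            j≡ : j ∸ i + (i + k) ≡ j + k
            j≡ = trans (sym (+-assoc (j ∸ i) i k)) (cong (_+ k) (m∸n+n≡m i≤j))

          far-unless-ends : ∀ {i j} → 2 + i ≤ j → j ≤ d → ¬ (i ≡ 0 × j ≡ d) →
                 ¬ Meet (a (i + k)) (a (j + k))
          -- Only for `i = 0` can the distance reach `d`; from `i = 1` on, `j ≤ d` already keeps it
          -- below `d`.
          far-unless-ends {zero}  {j} 2≤j   j≤d not-ends =
            far 2≤j (subst (j <_) (sym (+-identityʳ d))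
              (≤∧≢⇒< j≤d λ j≡d → not-ends (refl , j≡d)))
          far-unless-ends {suc i} {j} 3+i≤j j≤d _ =
            far 3+i≤j (≤-trans (s≤s j≤d) (subst (suc d ≤_) (sym (+-suc d i)) (s≤s (m≤m+n d i))))

          -- Otherwise `a k` would meet `a (pred d + k)`, the neighbour of `a (d + k)`. Their
          -- distance `pred d` is at least 2 and below `d`, which `shorter` forbids.
          ends-≉ : ¬ (a k ≈ᵥ a (d + k))
          ends-≉ ak≈ad = far-unless-ends {0} {pred d} (pred-mono-≤ 3≤d) pred[n]≤n
            (λ (_ , p≡d) → 1+n≢n (trans suc-pred-d (sym p≡d)))
            (Meet-respˡ (a (d + k)) (a k) (a (pred d + k))
              (≈ᵥ-sym {a k} {a (d + k)} ak≈ad)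
              (Meet-sym (a (pred d + k)) (a (d + k))
                (subst (Meet (a (pred d + k)) ∘ a) (cong (_+ k) suc-pred-d)
                  (consecutive-meet (pred d + k)))))
            where
            suc-pred-d : suc (pred d) ≡ d
            suc-pred-d = suc-pred d {{>-nonZero (≤-trans (s≤s z≤n) 3≤d)}}

          f-distinct-< : ∀ {i j} → i < j → j ≤ d → ¬ (a (i + k) ≈ᵥ a (j + k))
          f-distinct-< {i} {j} i<j j≤d ai≈aj with suc i ≟ j
          ... | yes refl = consecutive-≉ (i + k) ai≈aj
          -- Cosets are nonempty, so equal ones meet.
          ... | no  i+1≢j = far-unless-ends (≤∧≢⇒< i<j i+1≢j) j≤d
            (λ { (refl , refl) → ends-≉ ai≈aj }) (≈ᵥ⇒Meet (a (i + k)) (a (j + k)) ai≈aj)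

          toℕ≤d : (x : Fin (suc d)) → toℕ x ≤ d
          toℕ≤d x = ≤-pred (toℕ<n x)

          f-distinct : ∀ x y → x ≢ y → ¬ (f x ≈ᵥ f y)
          f-distinct x y x≢y fx≈fy with <-cmp (toℕ x) (toℕ y)
          ... | tri< x<y _ _ = f-distinct-< x<y (toℕ≤d y) fx≈fy
          ... | tri≈ _ x≡y _ = x≢y (toℕ-injective x≡y)
          ... | tri> _ _ y<x = f-distinct-< y<x (toℕ≤d x) (≈ᵥ-sym {f x} {f y} fx≈fy)

          f-adjacent : ∀ x → Gaifman (dual Γ) (f x) (f (next x))
          f-adjacent x with m≤n⇒m<n∨m≡n (toℕ≤d x)
          ... | inj₁ x<d rewrite toℕ-next-< x x<d = consecutive-Gaifman (toℕ x + k)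
          -- The edge from the last vertex back to the first is the assumed meeting `closed`.
          ... | inj₂ x≡d rewrite toℕ-next-last x x≡d | x≡d =
            Gaifman-sym (Meet⇒Gaifman ends-≉ closed)

          -- Not being neighbours means two things here: `y ≢ next x` raises the distance to at
          -- least 2, and `x ≢ next y` excludes the two ends, because `next` wraps from `d` to 0.
          no-chord-< : ∀ {x y} → toℕ x < toℕ y → y ≢ next x → x ≢ next y →
                       ¬ Meet (f x) (f y)
          no-chord-< {x} {y} x<y y≢x+1 x≢y+1 = far-unless-ends
            (≤∧≢⇒< x<y λ x+1≡y → y≢x+1 (toℕ-injective
              (trans (sym x+1≡y) (sym (toℕ-next-< x (<-≤-trans x<y (toℕ≤d y)))))))
            (toℕ≤d y)
            (λ (x≡0 , y≡d) → x≢y+1 (toℕ-injective (trans x≡0 (sym (toℕ-next-last y y≡d)))))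

          no-chord : ¬ HasChord (dual Γ) f
          no-chord (x , y , x≢y , y≢x+1 , x≢y+1 , xy) with <-cmp (toℕ x) (toℕ y)
          ... | tri< x<y _ _ = no-chord-< x<y y≢x+1 x≢y+1 (Gaifman⇒Meet xy)
          ... | tri≈ _ x≡y _ = x≢y (toℕ-injective x≡y)
          ... | tri> _ _ y<x = no-chord-< y<x x≢y+1 y≢x+1 (Meet-sym (f x) (f y) (Gaifman⇒Meet xy))

          impossible : ⊥
          impossible = no-chord (proj₂ acyclic (suc d) (s≤s 3≤d) d<n f record
            { distinct = f-distinct ; adjacent = f-adjacent })

        -- The start `k` is quantified after `d`, so that the induction hypothesis covers pairs
        -- starting anywhere along the cycle.
        ¬Meet : ∀ d → d < n → 2 ≤ d → ∀ k → ¬ Meet (a k) (a (d + k))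
        ¬Meet = <-rec _ λ d rec d<n 2≤d k m → case m≤n⇒m<n∨m≡n 2≤d of λ where
          (inj₂ refl) → ¬Meet-2 k m
          (inj₁ 3≤d)  → LongShortcut.impossible k d 3≤d d<n m
            λ e<d 2≤e → rec e<d (<-trans e<d d<n) 2≤e

-- Coset cycles as periodic sequences.

lemma3p19 : ∀ {c ℓ p} (G : CayleyGroup c ℓ p) (n : ℕ) →
    CayleyAcyclic G 2 →
    3 ≤ n →
    HypergraphAcyclic (dual G) n →
    CayleyAcyclic G n
lemma3p19 G n 2-acyclic 3≤n acyclic m m≤n C with m ≤? 2
lemma3p19 G n 2-acyclic 3≤n acyclic m m≤n C | yes m≤2 = 2-acyclic m m≤2 C
lemma3p19 G n 2-acyclic 3≤n acyclic zero m≤n C | no m≰2 = m≰2 z≤n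
lemma3p19 G n 2-acyclic 3≤n acyclic m@(suc m-1) m≤n C | no m≰2 =
  -- The distance is `m-1`: `m≤n` unfolds to `m-1 < n`, and `m` exceeding 2 gives `2 ≤ m-1`. The
  -- forbidden meeting is that of the consecutive cosets at `m-1` and `m`, the latter being `a 0` by
  -- periodicity.
  ¬Meet 2-acyclic 3≤n acyclic m-1 m≤n (≤-pred (≰⇒> m≰2)) 0
    (subst (λ b → Meet G b (a (m-1 + 0))) a-periodic
      (Meet-sym G (a (m-1 + 0)) (a (suc (m-1 + 0))) (consecutive-meet (m-1 + 0))))
  where
  open CosetCycle C
  open CayleyGroup G using (_⁻¹; _∙_; group)
  infixr 7 _∩′_
  _∩′_ = _∩ₑ_ G
  step′ : ∀ k → v (suc k mod m) ∈ coset G (v (k mod m)) (α (k mod m))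
  step′ k = \\-∈⇒coset G (α (k mod m))
    (subst (λ i → v (k mod m) ⁻¹ ∙ v i ∈ Generated group (SubsetE.set (α (k mod m))))
      (next-mod k m) (step (k mod m)))
  Disjoint : (h i j : Fin m) → Set _
  Disjoint h i j = Empty (coset G (v i) (α h ∩′ α i) ∩ coset G (v j) (α i ∩′ α j))
  disjoint′ : ∀ k → Disjoint (k mod m) (suc k mod m) (suc (suc k) mod m)
  disjoint′ k =
    subst (λ h → Disjoint h (suc k mod m) (suc (suc k) mod m)) (prev-mod k m)
      (subst (Disjoint (prev (suc k mod m)) (suc k mod m)) (next-mod (suc k) m)
        (disjoint (suc k mod m)))
  open CosetSequence G (λ k → v (k mod m)) (λ k → α (k mod m)) step′ disjoint′
  a-periodic : a (suc (m-1 + 0)) ≡ a 0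
  -- As `a` shifts indices by one, the residues compared are those of `1 + m` and 1.
  a-periodic = cong (λ i → α i , v i) (mod-cong (2 + (m-1 + 0)) 1 m
    (trans (cong (λ r → (2 + r) % m) (+-identityʳ m-1)) ([m+n]%n≡m%n 1 m)))
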